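{- For $3\le D\le 20000$ there is no graph of degree $13$, diameter $D$ and cyclic defect. Furthermore, for odd $g$ with $7\le g\le 40001$ there is no graph of degree $13$, girth $g$ and cyclic excess.
   Context: For an integer $d\ge 1$ define polynomials $G_{d,m}(x)$ by $G_{d,0}(x)=1$, $G_{d,1}(x)=x+1$, and $G_{d,m+1}(x)=xG_{d,m}(x)-(d-1)G_{d,m-1}(x)$ for $m\ge1$. Let $J_n$ be the $n\times n$ all-ones matrix. For a graph on $n\ge3$ vertices, a cycle matrix is the adjacency matrix $B$ of an $n$-cycle on the same vertex set (i.e., for some ordering $v_1,\dots,v_n$ of the vertices, $B_{ij}=1$ iff $v_i,v_j$ are cyclically consecutive, and $0$ otherwise); this cycle need not consist of edges of the graph. A graph $\Gamma$ of order $n$ with adjacency matrix $A$ is a graph of degree $d$, diameter $D$ and cyclic defect if $\Gamma$ is $d$-regular with $d\ge3$, has diameter $D\ge2$, and $G_{d,D}(A)=J_n+B$ for some cycle matrix $B$. It is a graph of degree $d$, girth $g$ and cyclic excess if $\Gamma$ is $d$-regular with $d\ge3$, has odd girth $g\ge5$, and $G_{d,\lfloor g/2\rfloor}(A)=J_n-B$ for some cycle matrix $B$. -}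

module Defs where

open import Data.Nat using (ℕ; zero; suc; _≤_; _<_; _∸_; _%_; _/_)
import Data.Nat as N
open import Data.Integer using (ℤ; +_; _+_; _*_; _-_)
open import Data.Fin using (Fin; toℕ)
import Data.Fin as F
open import Data.Bool using (Bool; true; false; if_then_else_)
open import Data.Product using (Σ; _×_; ∃; ∃-syntax)
open import Data.Sum using (_⊎_)
open import Relation.Binary.PropositionalEquality using (_≡_)
open import Relation.Nullary using (¬_)
open import Relation.Nullary.Decidable using (isYes)
open import Function.Definitions using (Injective)
open import Data.Fin.Permutation using (Permutation′; _⟨$⟩ʳ_)

∑ℕ : (n : ℕ) → (Fin n → ℕ) → ℕ
∑ℕ zero    f = 0
∑ℕ (suc n) f = f F.zero N.+ ∑ℕ n (λ i → f (F.suc i))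

∑ℤ : (n : ℕ) → (Fin n → ℤ) → ℤ
∑ℤ zero    f = + 0
∑ℤ (suc n) f = f F.zero + ∑ℤ n (λ i → f (F.suc i))

Mat : ℕ → Set
Mat n = Fin n → Fin n → ℤ

_⊕_ : ∀ {n} → Mat n → Mat n → Mat n
(X ⊕ Y) i j = X i j + Y i j

_⊖_ : ∀ {n} → Mat n → Mat n → Mat n
(X ⊖ Y) i j = X i j - Y i j

_⊛_ : ∀ {n} → Mat n → Mat n → Mat n
_⊛_ {n} X Y i j = ∑ℤ n (λ k → X i k * Y k j)

_·_ : ∀ {n} → ℤ → Mat n → Mat n
(c · X) i j = c * X i j

Id : ∀ {n} → Mat n
Id i j = if isYes (i F.≟ j) then + 1 else + 0

Jm : ∀ {n} → Mat n
Jm i j = + 1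

Gmat : ∀ {n} → ℕ → ℕ → Mat n → Mat n
Gmat d zero          X = Id
Gmat d (suc zero)    X = X ⊕ Id
Gmat d (suc (suc m)) X = (X ⊛ Gmat d (suc m) X) ⊖ ((+ (d ∸ 1)) · Gmat d m X)

record Graph (n : ℕ) : Set where
  field
    adj    : Fin n → Fin n → Bool
    sym    : ∀ i j → adj i j ≡ adj j i
    irrefl : ∀ i → adj i i ≡ false
open Graph public

AdjMat : ∀ {n} → Graph n → Mat n
AdjMat G i j = if adj G i j then + 1 else + 0

degree : ∀ {n} → Graph n → Fin n → ℕ
degree {n} G i = ∑ℕ n (λ j → if adj G i j then 1 else 0)

Regular : ∀ {n} → Graph n → ℕ → Set
Regular G d = ∀ i → degree G i ≡ d

data Walk {n : ℕ} (G : Graph n) : ℕ → Fin n → Fin n → Set where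
  here : ∀ {i} → Walk G 0 i i
  step : ∀ {k i j l} → adj G i j ≡ true → Walk G k j l → Walk G (suc k) i l

DistLe : ∀ {n} → Graph n → ℕ → Fin n → Fin n → Set
DistLe G k i j = ∃[ m ] (m ≤ k × Walk G m i j)

Diameter : ∀ {n} → Graph n → ℕ → Set
Diameter G D =
  (∀ i j → DistLe G D i j) ×
  (∃[ i ] ∃[ j ] (∀ m → m < D → ¬ Walk G m i j))

record Cycle {n : ℕ} (G : Graph n) (k : ℕ) : Set where
  field
    len≥3 : 3 ≤ k
    vert  : Fin k → Fin n
    inj   : Injective _≡_ _≡_ vert
    edge  : ∀ (a b : Fin k) → N.suc (toℕ a) ≡ toℕ b → adj G (vert a) (vert b) ≡ true
    close : ∀ (a b : Fin k) → toℕ a ≡ 0 → N.suc (toℕ b) ≡ k → adj G (vert b) (vert a) ≡ true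

Girth : ∀ {n} → Graph n → ℕ → Set
Girth G g = Cycle G g × (∀ k → k < g → ¬ Cycle G k)

Consec : (n : ℕ) → Fin n → Fin n → Set
Consec n a b =
  (N.suc (toℕ a) ≡ toℕ b) ⊎ (N.suc (toℕ b) ≡ toℕ a) ⊎
  ((toℕ a ≡ 0) × (N.suc (toℕ b) ≡ n)) ⊎ ((toℕ b ≡ 0) × (N.suc (toℕ a) ≡ n))

IsCycleMatrix : ∀ {n} → Mat n → Set
IsCycleMatrix {n} B = Σ (Permutation′ n) λ π →
  (∀ i j → (Consec n (π ⟨$⟩ʳ i) (π ⟨$⟩ʳ j) → B i j ≡ + 1) ×
           (¬ Consec n (π ⟨$⟩ʳ i) (π ⟨$⟩ʳ j) → B i j ≡ + 0))

MatEq : ∀ {n} → Mat n → Mat n → Set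
MatEq X Y = ∀ i j → X i j ≡ Y i j

CyclicDefect : (n d D : ℕ) → Graph n → Set
CyclicDefect n d D G =
  3 ≤ n × Regular G d × 3 ≤ d × Diameter G D × 2 ≤ D ×
  ∃[ B ] (IsCycleMatrix B × MatEq (Gmat d D (AdjMat G)) (Jm ⊕ B))

CyclicExcess : (n d g : ℕ) → Graph n → Set
CyclicExcess n d g G =
  3 ≤ n × Regular G d × 3 ≤ d × Girth G g × g % 2 ≡ 1 × 5 ≤ g ×
  ∃[ B ] (IsCycleMatrix B × MatEq (Gmat d (g / 2) (AdjMat G)) (Jm ⊖ B))

{-# OPTIONS --safe #-}
-- Write G_m for G_{13,m}, and G_m(A) = J + εB with ε = ±1. Row sums give n + 2ε = G_m(13), which is even,
-- so B has the alternating vector w (signs along the cycle) as eigenvector for -2, and this eigenspace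
-- is a line, orthogonal to the all-ones vector. Since A commutes with B, Aw = xw; as w has entries ±1,
-- x = 13 - 2c with 0 ≤ c ≤ 13, and G_m(x) = -2ε. Congruences rule this out for every m ≥ 2:
-- if N divides (x - 13)r, then a residue r modulo N shared by two consecutive values G_m(x) persists for
-- all later ones. Suitable N ∈ {3, 4, 8, 16} exist except for x = -11, ε = -1, where G_m(-11) ≡ ±1 mod 11.
module Submission where

open import Defs
open import Data.Nat using (ℕ; zero; suc; _≤_; _<_; _∸_; _%_; _/_; z≤n; s≤s)
import Data.Nat as N
import Data.Nat.Properties as N
import Data.Nat.Divisibility as ∣ᵤ
open import Data.Nat.DivMod
  using (_mod_; m≡m%n+[m/n]*n; m%n<n; m<n⇒m%n≡m; n%n≡0; [m+n]%n≡m%n; [m+kn]%n≡m%n; %-distribˡ-+; /-monoˡ-≤)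
open import Data.Integer using (ℤ; +_; -[1+_]; -_; _+_; _*_; _-_)
open import Data.Integer.Properties
  using (+-0-commutativeMonoid; +-identityˡ; +-identityʳ; +-inverseʳ; *-zeroˡ; *-zeroʳ; *-comm;
         *-assoc; *-distribˡ-+; neg-distribˡ-*; -1*i≡-i; *-identityˡ; *-identityʳ; i*j≡0⇒i≡0∨j≡0; *-cancelˡ-≡; _≟_)
open import Data.Integer.Divisibility.Signed
  using (_∣_; divides; ∣⇒∣ᵤ; _∣?_; ∣m∣n⇒∣m+n; ∣m∣n⇒∣m-n; ∣n⇒∣m*n; ∣-refl)
open import Data.Integer.Tactic.RingSolver using (solve-∀)
open import Data.Fin using (Fin; toℕ)
import Data.Fin as F
open import Data.Fin.Properties using (all?; toℕ<n; toℕ-fromℕ<; toℕ-injective)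
open import Data.Fin.Permutation using (Permutation′; _⟨$⟩ʳ_; _⟨$⟩ˡ_; inverseˡ; inverseʳ)
open import Data.Bool using (Bool; true; false; if_then_else_)
open import Data.List using (List; []; _∷_)
open import Data.List.Relation.Unary.Any using (Any; any?; satisfied)
open import Data.Product using (_×_; _,_; proj₁; proj₂; ∃-syntax)
open import Data.Sum using (_⊎_; inj₁; inj₂; [_,_]′)
open import Relation.Binary.PropositionalEquality
  using (_≡_; _≢_; refl; trans; cong; cong₂; subst; module ≡-Reasoning)
import Relation.Binary.PropositionalEquality as Eq
open import Relation.Nullary using (¬_; Dec; yes; no; contradiction)
open import Relation.Nullary.Decidable using (from-yes; from-no; ¬?; _×-dec_; _⊎-dec_)
import Algebra.Properties.CommutativeMonoid.Sum +-0-commutativeMonoid as Sum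
open ≡-Reasoning

-- Integer values of the polynomials and their congruences in degree 13.

gpoly : ℕ → ℕ → ℤ → ℤ
gpoly d zero          x = + 1
gpoly d (suc zero)    x = x + + 1
gpoly d (suc (suc m)) x = x * gpoly d (suc m) x - + (d ∸ 1) * gpoly d m x

-- Modulo `N` the constant sequence `r` satisfies the recurrence exactly when `x * r - 12 * r` is
-- congruent to `r`, and this is the first divisibility; induction then subtracts `r` from every
-- term.
residue-persists : ∀ N r x k → N ∣ (x - + 13) * r → N ∣ gpoly 13 k x - r → N ∣ gpoly 13 (suc k) x - r →
                   ∀ m → N ∣ gpoly 13 (m N.+ k) x - r
residue-persists N r x k h h₀ h₁ zero          = h₀
residue-persists N r x k h h₀ h₁ (suc zero)    = h₁
residue-persists N r x k h h₀ h₁ (suc (suc m)) =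
  subst (N ∣_) (Eq.sym (rearrange x (gpoly 13 (suc m N.+ k) x) (gpoly 13 (m N.+ k) x) r))
    (∣m∣n⇒∣m+n (∣m∣n⇒∣m-n (∣n⇒∣m*n x (residue-persists N r x k h h₀ h₁ (suc m)))
                          (∣n⇒∣m*n (+ 12) (residue-persists N r x k h h₀ h₁ m))) h)
  where
  rearrange : ∀ x a b r → x * a - + 12 * b - r ≡ x * (a - r) - + 12 * (b - r) + (x - + 13) * r
  rearrange = solve-∀

-- A decidable certificate, on the values at indices 2 and 3 alone, that `t` is missed at every
-- index from 2 on.
Excludes : ℤ → ℤ → ℤ × ℤ → Set
Excludes t x (N , r) =
  N ∣ (x - + 13) * r × N ∣ gpoly 13 2 x - r × N ∣ gpoly 13 3 x - r × ¬ (N ∣ t - r)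

excludes? : ∀ t x Nr → Dec (Excludes t x Nr)
excludes? t x (N , r) =
  (N ∣? _) ×-dec (N ∣? _) ×-dec (N ∣? _) ×-dec ¬? (N ∣? _)

excludes⇒≢ : ∀ t x Nr → Excludes t x Nr → ∀ m → gpoly 13 (m N.+ 2) x ≢ t
excludes⇒≢ t x (N , r) (h , h₂ , h₃ , ¬t) m eq =
  ¬t (subst (λ y → N ∣ y - r) eq (residue-persists N r x 2 h h₂ h₃ m))

eigenvalue : Fin 14 → ℤ
eigenvalue c = + 13 - + 2 * + toℕ c

-- Modulo 3 the coefficient 12 vanishes. From index 2 on the values are 2 when `x` is congruent to
-- 1, and 0 otherwise, whereas -2 is congruent to 1.
residues₋₂ : List (ℤ × ℤ)
residues₋₂ = (+ 3 , + 0) ∷ (+ 3 , + 2) ∷ []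

excluded₋₂ : ∀ c → Any (Excludes (- + 2) (eigenvalue c)) residues₋₂
excluded₋₂ = from-yes (all? λ c → any? (excludes? (- + 2) (eigenvalue c)) residues₋₂)

gpoly≢-2 : ∀ c m → gpoly 13 (m N.+ 2) (eigenvalue c) ≢ - + 2
gpoly≢-2 c m = let Nr , e = satisfied (excluded₋₂ c) in excludes⇒≢ _ _ Nr e m

-- Modulo 11 one has -11 = 0 and 12 = 1, so the value at index `m + 2` is the negative of the value
-- at index `m`; the first two values, 1 and -10, are both congruent to 1.
gpoly[-11]≡±1mod11 : ∀ m → + 11 ∣ gpoly 13 m (-[1+ 10 ]) - + 1 ⊎ + 11 ∣ gpoly 13 m (-[1+ 10 ]) + + 1
gpoly[-11]≡±1mod11 zero          = inj₁ (divides (+ 0) refl)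
gpoly[-11]≡±1mod11 (suc zero)    = inj₁ (divides -[1+ 0 ] refl)
gpoly[-11]≡±1mod11 (suc (suc m)) with gpoly[-11]≡±1mod11 m
... | inj₁ h = inj₂ (subst (+ 11 ∣_) (Eq.sym (rearrange (gpoly 13 (suc m) _) (gpoly 13 m _)))
                     (∣m∣n⇒∣m-n (∣n⇒∣m*n (- (gpoly 13 (suc m) _ + gpoly 13 m _)) ∣-refl) h))
  where
  rearrange : ∀ a b → -[1+ 10 ] * a - + 12 * b + + 1 ≡ - (a + b) * + 11 - (b - + 1)
  rearrange = solve-∀
... | inj₂ h = inj₁ (subst (+ 11 ∣_) (Eq.sym (rearrange (gpoly 13 (suc m) _) (gpoly 13 m _)))
                     (∣m∣n⇒∣m-n (∣n⇒∣m*n (- (gpoly 13 (suc m) _ + gpoly 13 m _)) ∣-refl) h))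
  where
  rearrange : ∀ a b → -[1+ 10 ] * a - + 12 * b - + 1 ≡ - (a + b) * + 11 - (b + + 1)
  rearrange = solve-∀

gpoly[-11]≢2 : ∀ m → gpoly 13 m (-[1+ 10 ]) ≢ + 2
gpoly[-11]≢2 m eq with gpoly[-11]≡±1mod11 m
... | inj₁ h = from-no (+ 11 ∣? + 1) (subst (λ y → + 11 ∣ y - + 1) eq h)
... | inj₂ h = from-no (+ 11 ∣? + 3) (subst (λ y → + 11 ∣ y + + 1) eq h)

-- For `x` congruent to 1 modulo 3 the persistent residue is 2, the target itself, so other moduli
-- are needed: 4 settles 7 and -5, 8 settles 1, 16 settles 13. Only -11 remains.
residues₂ : List (ℤ × ℤ)
residues₂ = (+ 3 , + 0) ∷ (+ 4 , + 0) ∷ (+ 8 , + 6) ∷ (+ 16 , + 10) ∷ []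

excluded₂ : ∀ c → Any (Excludes (+ 2) (eigenvalue c)) residues₂ ⊎ eigenvalue c ≡ -[1+ 10 ]
excluded₂ = from-yes (all? λ c → any? (excludes? (+ 2) (eigenvalue c)) residues₂
  ⊎-dec (eigenvalue c ≟ -[1+ 10 ]))

gpoly≢2 : ∀ c m → gpoly 13 (m N.+ 2) (eigenvalue c) ≢ + 2
gpoly≢2 c m = [ (λ e → let Nr , e′ = satisfied e in excludes⇒≢ _ _ Nr e′ m)
              , (λ h → subst (λ x → gpoly 13 (m N.+ 2) x ≢ + 2) (Eq.sym h) (gpoly[-11]≢2 (m N.+ 2)))
              ]′ (excluded₂ c)

gpoly[13]-even : ∀ m → + 2 ∣ gpoly 13 (m N.+ 2) (+ 13)
gpoly[13]-even m = subst (+ 2 ∣_) (+-identityʳ _)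
  -- The quotients 85 and 1021 come from the values 170 and 2042 at 13 for indices 2 and 3.
  (residue-persists (+ 2) (+ 0) (+ 13) 2 (divides (+ 0) refl) (divides (+ 85) refl) (divides (+ 1021) refl) m)

-- Finite sums of integers

∑-cong : ∀ {n} {f g : Fin n → ℤ} → (∀ i → f i ≡ g i) → ∑ℤ n f ≡ ∑ℤ n g
∑-cong {zero}  h = refl
∑-cong {suc n} h = cong₂ _+_ (h F.zero) (∑-cong λ i → h (F.suc i))

∑-+ : ∀ n (f g : Fin n → ℤ) → ∑ℤ n (λ i → f i + g i) ≡ ∑ℤ n f + ∑ℤ n g
∑-+ zero    f g = refl
∑-+ (suc n) f g = trans (cong (_+_ (f F.zero + g F.zero)) (∑-+ n (λ i → f (F.suc i)) (λ i → g (F.suc i))))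
  (rearrange (f F.zero) (g F.zero) _ _)
  where
  rearrange : ∀ a b s t → a + b + (s + t) ≡ a + s + (b + t)
  rearrange = solve-∀

∑-*ˡ : ∀ n c (f : Fin n → ℤ) → ∑ℤ n (λ i → c * f i) ≡ c * ∑ℤ n f
∑-*ˡ zero    c f = Eq.sym (*-zeroʳ c)
∑-*ˡ (suc n) c f = trans (cong (_+_ (c * f F.zero)) (∑-*ˡ n c (λ i → f (F.suc i)))) (distrib c (f F.zero) _)
  where
  distrib : ∀ c a b → c * a + c * b ≡ c * (a + b)
  distrib = solve-∀

∑-*ʳ : ∀ n c (f : Fin n → ℤ) → ∑ℤ n (λ i → f i * c) ≡ ∑ℤ n f * c
∑-*ʳ n c f = trans (∑-cong λ i → *-comm (f i) c) (trans (∑-*ˡ n c f) (*-comm c _))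

∑-sub : ∀ n c (f g : Fin n → ℤ) → ∑ℤ n (λ i → f i - c * g i) ≡ ∑ℤ n f - c * ∑ℤ n g
∑-sub n c f g = begin
  ∑ℤ n (λ i → f i - c * g i)           ≡⟨ ∑-cong (λ i → as-sum (f i) c (g i)) ⟩
  ∑ℤ n (λ i → f i + - c * g i)         ≡⟨ ∑-+ n f _ ⟩
  ∑ℤ n f + ∑ℤ n (λ i → - c * g i)      ≡⟨ cong (_+_ (∑ℤ n f)) (∑-*ˡ n (- c) g) ⟩
  ∑ℤ n f + - c * ∑ℤ n g                ≡⟨ as-sum (∑ℤ n f) c _ ⟨
  ∑ℤ n f - c * ∑ℤ n g                  ∎
  where
  as-sum : ∀ a c b → a - c * b ≡ a + - c * b
  as-sum = solve-∀

∑-1 : ∀ n → ∑ℤ n (λ _ → + 1) ≡ + n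
∑-1 zero    = refl
∑-1 (suc n) = cong (_+_ (+ 1)) (∑-1 n)

-- Passing to the library sum gives access to the exchange of double sums and to invariance under
-- permutations.
∑≡sum : ∀ n (f : Fin n → ℤ) → ∑ℤ n f ≡ Sum.sum f
∑≡sum zero    f = refl
∑≡sum (suc n) f = cong (_+_ (f F.zero)) (∑≡sum n λ i → f (F.suc i))

∑-comm : ∀ m n (f : Fin m → Fin n → ℤ) →
         ∑ℤ m (λ i → ∑ℤ n (f i)) ≡ ∑ℤ n (λ j → ∑ℤ m (λ i → f i j))
∑-comm m n f = begin
  ∑ℤ m (λ i → ∑ℤ n (f i))                      ≡⟨ ∑-cong (λ i → ∑≡sum n (f i)) ⟩
  ∑ℤ m (λ i → Sum.sum (f i))                   ≡⟨ ∑≡sum m _ ⟩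
  Sum.sum (λ i → Sum.sum (f i))                ≡⟨ Sum.∑-comm f ⟩
  Sum.sum (λ j → Sum.sum (λ i → f i j))        ≡⟨ ∑≡sum n _ ⟨
  ∑ℤ n (λ j → Sum.sum (λ i → f i j))           ≡⟨ ∑-cong (λ j → ∑≡sum m (λ i → f i j)) ⟨
  ∑ℤ n (λ j → ∑ℤ m (λ i → f i j))              ∎

∑-permute : ∀ n (f : Fin n → ℤ) (π : Permutation′ n) → ∑ℤ n (λ i → f (π ⟨$⟩ʳ i)) ≡ ∑ℤ n f
∑-permute n f π = trans (∑≡sum n _) (trans (Eq.sym (Sum.sum-permute f π)) (Eq.sym (∑≡sum n f)))

-- Matrices acting on vectors

Vect : ℕ → Set
Vect n = Fin n → ℤ

app : ∀ {n} → Mat n → Vect n → Vect n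
app {n} X v i = ∑ℤ n (λ k → X i k * v k)

app-congˡ : ∀ {n} {X Y : Mat n} v → MatEq X Y → ∀ i → app X v i ≡ app Y v i
app-congˡ v h i = ∑-cong λ k → cong (_* v k) (h i k)

app-congʳ : ∀ {n} (X : Mat n) {u v} → (∀ i → u i ≡ v i) → ∀ i → app X u i ≡ app X v i
app-congʳ X h i = ∑-cong λ k → cong (X i k *_) (h k)

app-⊕ : ∀ {n} (X Y : Mat n) v i → app (X ⊕ Y) v i ≡ app X v i + app Y v i
app-⊕ {n} X Y v i = trans (∑-cong λ k → distrib (X i k) (Y i k) (v k)) (∑-+ n _ _)
  where
  distrib : ∀ a b c → (a + b) * c ≡ a * c + b * c
  distrib = solve-∀

app-· : ∀ {n} c (X : Mat n) v i → app (c · X) v i ≡ c * app X v i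
app-· {n} c X v i = trans (∑-cong λ k → *-assoc c (X i k) (v k)) (∑-*ˡ n c _)

app-⊖· : ∀ {n} (X Y : Mat n) c v i → app (X ⊖ (c · Y)) v i ≡ app X v i - c * app Y v i
app-⊖· {n} X Y c v i = trans (∑-cong λ k → distrib (X i k) c (Y i k) (v k)) (∑-sub n c _ _)
  where
  distrib : ∀ a c b x → (a - c * b) * x ≡ a * x - c * (b * x)
  distrib = solve-∀

app-⊛ : ∀ {n} (X Y : Mat n) v i → app (X ⊛ Y) v i ≡ app X (app Y v) i
app-⊛ {n} X Y v i = begin
  ∑ℤ n (λ k → ∑ℤ n (λ l → X i l * Y l k) * v k)    ≡⟨ ∑-cong (λ k → ∑-*ʳ n (v k) _) ⟨
  ∑ℤ n (λ k → ∑ℤ n (λ l → X i l * Y l k * v k))    ≡⟨ ∑-comm n n _ ⟩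
  ∑ℤ n (λ l → ∑ℤ n (λ k → X i l * Y l k * v k))
    ≡⟨ ∑-cong (λ l → trans (∑-cong λ k → *-assoc (X i l) (Y l k) (v k)) (∑-*ˡ n (X i l) _)) ⟩
  ∑ℤ n (λ l → X i l * ∑ℤ n (λ k → Y l k * v k))    ∎

app-+ : ∀ {n} (X : Mat n) u v i → app X (λ k → u k + v k) i ≡ app X u i + app X v i
app-+ {n} X u v i = trans (∑-cong λ k → *-distribˡ-+ (X i k) (u k) (v k)) (∑-+ n _ _)

app-* : ∀ {n} (X : Mat n) c v i → app X (λ k → c * v k) i ≡ c * app X v i
app-* {n} X c v i = trans (∑-cong λ k → swap (X i k) c (v k)) (∑-*ˡ n c _)
  where
  swap : ∀ a c b → a * (c * b) ≡ c * (a * b)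
  swap = solve-∀

app-sub : ∀ {n} (X : Mat n) u c v i → app X (λ k → u k - c * v k) i ≡ app X u i - c * app X v i
app-sub {n} X u c v i = trans (∑-cong λ k → distrib (X i k) (u k) c (v k)) (∑-sub n c _ _)
  where
  distrib : ∀ a x c y → a * (x - c * y) ≡ a * x - c * (a * y)
  distrib = solve-∀

-- After exchanging the sums, each `v k` is weighted by a column sum. Hence such a matrix preserves
-- the vectors of sum zero.
∑-app : ∀ {n} (X : Mat n) s → (∀ k → ∑ℤ n (λ i → X i k) ≡ s) → ∀ v → ∑ℤ n (app X v) ≡ s * ∑ℤ n v
∑-app {n} X s column-sum v = begin
  ∑ℤ n (λ i → ∑ℤ n (λ k → X i k * v k))    ≡⟨ ∑-comm n n _ ⟩
  ∑ℤ n (λ k → ∑ℤ n (λ i → X i k * v k))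
    ≡⟨ ∑-cong (λ k → trans (∑-*ʳ n (v k) _) (cong (_* v k) (column-sum k))) ⟩
  ∑ℤ n (λ k → s * v k)                     ≡⟨ ∑-*ˡ n s v ⟩
  s * ∑ℤ n v                               ∎

Id-suc : ∀ {n} (i j : Fin n) → Id (F.suc i) (F.suc j) ≡ Id i j
Id-suc i j with i F.≟ j
... | yes _ = refl
... | no  _ = refl

∑-0* : ∀ {n} (v : Vect n) → ∑ℤ n (λ k → + 0 * v k) ≡ + 0
∑-0* {n} v = trans (∑-*ˡ n (+ 0) v) (*-zeroˡ (∑ℤ n v))

app-Id : ∀ {n} (v : Vect n) i → app Id v i ≡ v i
app-Id v F.zero    = trans (cong₂ _+_ (*-identityˡ (v F.zero)) (∑-0* λ k → v (F.suc k))) (+-identityʳ _)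
app-Id v (F.suc i) = trans (cong₂ _+_ (*-zeroˡ (v F.zero))
  (trans (∑-cong λ k → cong (_* v (F.suc k)) (Id-suc i k)) (app-Id (λ k → v (F.suc k)) i))) (+-identityˡ _)

-- Polynomials in a matrix acting on vectors

gapp : ∀ {n} → ℕ → ℕ → Mat n → Vect n → Vect n
gapp d zero          X v i = v i
gapp d (suc zero)    X v i = app X v i + v i
gapp d (suc (suc m)) X v i = app X (gapp d (suc m) X v) i - + (d ∸ 1) * gapp d m X v i

-- This moves the recurrence from matrices to vectors, where commutation and eigenvalues follow by
-- induction from linearity of `app X`, without any algebra of matrix products.
app-Gmat : ∀ {n} d m (X : Mat n) v i → app (Gmat d m X) v i ≡ gapp d m X v i
app-Gmat d zero          X v i = app-Id v i
app-Gmat d (suc zero)    X v i = trans (app-⊕ X Id v i) (cong (_+_ (app X v i)) (app-Id v i))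
app-Gmat d (suc (suc m)) X v i = begin
  app (Gmat d (suc (suc m)) X) v i
    ≡⟨ app-⊖· (X ⊛ Gmat d (suc m) X) (Gmat d m X) (+ (d ∸ 1)) v i ⟩
  app (X ⊛ Gmat d (suc m) X) v i - + (d ∸ 1) * app (Gmat d m X) v i
    ≡⟨ cong₂ (λ a b → a - + (d ∸ 1) * b)
         (trans (app-⊛ X (Gmat d (suc m) X) v i) (app-congʳ X (app-Gmat d (suc m) X v) i))
         (app-Gmat d m X v i) ⟩
  gapp d (suc (suc m)) X v i ∎

-- A polynomial in `X` commutes with `X`. This stands in for the commutation of `A` with `B`.
gapp-comm : ∀ {n} d m (X : Mat n) v i → gapp d m X (app X v) i ≡ app X (gapp d m X v) i
gapp-comm d zero          X v i = refl
gapp-comm d (suc zero)    X v i = Eq.sym (app-+ X (app X v) v i)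
gapp-comm d (suc (suc m)) X v i = begin
  app X (gapp d (suc m) X (app X v)) i - + (d ∸ 1) * gapp d m X (app X v) i
    ≡⟨ cong₂ (λ a b → a - + (d ∸ 1) * b) (app-congʳ X (gapp-comm d (suc m) X v) i) (gapp-comm d m X v i) ⟩
  app X (app X (gapp d (suc m) X v)) i - + (d ∸ 1) * app X (gapp d m X v) i
    ≡⟨ app-sub X (app X (gapp d (suc m) X v)) (+ (d ∸ 1)) (gapp d m X v) i ⟨
  app X (gapp d (suc (suc m)) X v) i ∎

gapp-eigen : ∀ {n} d m (X : Mat n) v x → (∀ i → app X v i ≡ x * v i) →
             ∀ i → gapp d m X v i ≡ gpoly d m x * v i
gapp-eigen d zero          X v x h i = Eq.sym (*-identityˡ (v i))
gapp-eigen d (suc zero)    X v x h i = trans (cong (_+ v i) (h i)) (distrib x (v i))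
  where
  distrib : ∀ x a → x * a + a ≡ (x + + 1) * a
  distrib = solve-∀
gapp-eigen d (suc (suc m)) X v x h i = begin
  app X (gapp d (suc m) X v) i - c * gapp d m X v i
    ≡⟨ cong₂ (λ a b → a - c * b)
         (trans (app-congʳ X (gapp-eigen d (suc m) X v x h) i)
                (trans (app-* X (gpoly d (suc m) x) v i) (cong (gpoly d (suc m) x *_) (h i))))
         (gapp-eigen d m X v x h i) ⟩
  gpoly d (suc m) x * (x * v i) - c * (gpoly d m x * v i)
    ≡⟨ rearrange (gpoly d (suc m) x) x (v i) c (gpoly d m x) ⟩
  gpoly d (suc (suc m)) x * v i ∎
  where
  c : ℤ
  c = + (d ∸ 1)
  rearrange : ∀ p x a c q → p * (x * a) - c * (q * a) ≡ (x * p - c * q) * a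
  rearrange = solve-∀

-- Alternating signs

alt : ℕ → ℤ
alt zero    = + 1
alt (suc k) = - alt k

alt-±1 : ∀ k → alt k ≡ + 1 ⊎ alt k ≡ - + 1
alt-±1 zero    = inj₁ refl
alt-±1 (suc k) with alt-±1 k
... | inj₁ h = inj₂ (cong -_ h)
... | inj₂ h = inj₁ (cong -_ h)

alt*alt : ∀ k → alt k * alt k ≡ + 1
alt*alt k with alt-±1 k
... | inj₁ h = cong (λ a → a * a) h
... | inj₂ h = cong (λ a → a * a) h

alt-+ : ∀ k l → alt (k N.+ l) ≡ alt k * alt l
alt-+ zero    l = Eq.sym (*-identityˡ (alt l))
alt-+ (suc k) l = trans (cong -_ (alt-+ k l)) (neg-distribˡ-* (alt k) (alt l))

alt-multiple : ∀ n → alt n ≡ + 1 → ∀ q → alt (q N.* n) ≡ + 1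
alt-multiple n h zero    = refl
alt-multiple n h (suc q) = trans (alt-+ n (q N.* n)) (cong₂ _*_ h (alt-multiple n h q))

-- Dropping a multiple of `n` costs no sign when `n` is even; the alternating sign is thus well
-- defined around an even cycle.
alt-% : ∀ n .{{_ : N.NonZero n}} → alt n ≡ + 1 → ∀ k → alt (k % n) ≡ alt k
alt-% n h k = Eq.sym (begin
  alt k                              ≡⟨ cong alt (m≡m%n+[m/n]*n k n) ⟩
  alt (k % n N.+ k / n N.* n)        ≡⟨ alt-+ (k % n) (k / n N.* n) ⟩
  alt (k % n) * alt (k / n N.* n)    ≡⟨ cong (alt (k % n) *_) (alt-multiple n h (k / n)) ⟩
  alt (k % n) * + 1                  ≡⟨ *-identityʳ (alt (k % n)) ⟩
  alt (k % n)                        ∎)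

-- The sum is 0 or 1 according to the parity of `n`; doubling allows a single closed formula without
-- a case split.
2*∑-alt : ∀ n → + 2 * ∑ℤ n (λ i → alt (toℕ i)) ≡ + 1 - alt n
2*∑-alt zero    = refl
2*∑-alt (suc n) = begin
  + 2 * (+ 1 + ∑ℤ n (λ i → - alt (toℕ i)))
    ≡⟨ cong (λ s → + 2 * (+ 1 + s)) (trans (∑-cong {n} λ i → as-* (alt (toℕ i))) (∑-*ˡ n (- + 1) _)) ⟩
  + 2 * (+ 1 + - + 1 * S)    ≡⟨ expand S ⟩
  + 2 - + 2 * S              ≡⟨ cong (_-_ (+ 2)) (2*∑-alt n) ⟩
  + 2 - (+ 1 - alt n)        ≡⟨ collect (alt n) ⟩
  + 1 - - alt n              ∎
  where
  S = ∑ℤ n (λ i → alt (toℕ i))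
  as-* : ∀ a → - a ≡ - + 1 * a
  as-* = solve-∀
  expand : ∀ s → + 2 * (+ 1 + - + 1 * s) ≡ + 2 - + 2 * s
  expand = solve-∀
  collect : ∀ a → + 2 - (+ 1 - a) ≡ + 1 - - a
  collect = solve-∀

∑-alt-even : ∀ n → alt n ≡ + 1 → ∑ℤ n (λ i → alt (toℕ i)) ≡ + 0
∑-alt-even n h = *-cancelˡ-≡ (+ 2) _ _ (trans (2*∑-alt n) (cong (_-_ (+ 1)) h))

indicator : Bool → ℤ
indicator b = if b then + 1 else + 0

-- The witness `c` counts the selected indices of sign -1, each of which lowers the total by 2. The
-- bound on `c` leaves finitely many candidate eigenvalues.
signed-count : ∀ {n} (b : Fin n → Bool) (x : Fin n → ℕ) →
  ∃[ c ] (c ≤ ∑ℕ n (λ j → if b j then 1 else 0) ×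
          ∑ℤ n (λ j → indicator (b j) * alt (x j)) ≡ + ∑ℕ n (λ j → if b j then 1 else 0) - + 2 * + c)
signed-count {zero}  b x = 0 , z≤n , refl
signed-count {suc n} b x with signed-count (λ j → b (F.suc j)) (λ j → x (F.suc j)) | b F.zero
... | c , c≤ , eq | false = c , c≤ , trans (cong₂ _+_ (*-zeroˡ (alt (x F.zero))) eq) (+-identityˡ _)
... | c , c≤ , eq | true with alt-±1 (x F.zero)
... | inj₁ h = c , N.m≤n⇒m≤1+n c≤ , trans (cong₂ _+_ (cong (+ 1 *_) h) eq) (shift (+ ∑ℕ n _) (+ c))
  where
  shift : ∀ s c → + 1 + (s - + 2 * c) ≡ + 1 + s - + 2 * c
  shift = solve-∀
... | inj₂ h = suc c , s≤s c≤ , trans (cong₂ _+_ (cong (+ 1 *_) h) eq) (shift (+ ∑ℕ n _) (+ c))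
  where
  shift : ∀ s c → - + 1 + (s - + 2 * c) ≡ + 1 + s - + 2 * (+ 1 + c)
  shift = solve-∀

∑-indicator : ∀ {n} (b : Fin n → Bool) →
              ∑ℤ n (λ j → indicator (b j)) ≡ + ∑ℕ n (λ j → if b j then 1 else 0)
∑-indicator {zero}  b = refl
∑-indicator {suc n} b with b F.zero
... | true  = cong (_+_ (+ 1)) (∑-indicator λ j → b (F.suc j))
... | false = trans (+-identityˡ _) (∑-indicator λ j → b (F.suc j))

-- Cyclic succession modulo `n`

suc-%-cong : ∀ n .{{_ : N.NonZero n}} k → suc (k % n) % n ≡ suc k % n
suc-%-cong n k = begin
  suc (k % n) % n                      ≡⟨ [m+kn]%n≡m%n (suc (k % n)) (k / n) n ⟨
  suc (k % n N.+ k / n N.* n) % n      ≡⟨ cong (λ l → suc l % n) (m≡m%n+[m/n]*n k n) ⟨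
  suc k % n                            ∎

-- Adding the modulus minus one undoes a successor modulo the modulus.
suc-%-cancel : ∀ n .{{_ : N.NonZero n}} k l → suc k % n ≡ suc l % n → k % n ≡ l % n
suc-%-cancel (suc n) k l h = begin
  k % suc n                                    ≡⟨ shift k ⟩
  (suc k % suc n N.+ n % suc n) % suc n        ≡⟨ cong (λ r → (r N.+ n % suc n) % suc n) h ⟩
  (suc l % suc n N.+ n % suc n) % suc n        ≡⟨ shift l ⟨
  l % suc n                                    ∎
  where
  shift : ∀ k → k % suc n ≡ (suc k % suc n N.+ n % suc n) % suc n
  shift k = begin
    k % suc n                                  ≡⟨ [m+n]%n≡m%n k (suc n) ⟨
    (k N.+ suc n) % suc n                      ≡⟨ cong (_% suc n) (N.+-suc k n) ⟩
    (suc k N.+ n) % suc n                      ≡⟨ %-distribˡ-+ (suc k) n (suc n) ⟩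
    (suc k % suc n N.+ n % suc n) % suc n      ∎

-- Cancelling successors reduces to 0 against 2, which differ as both are below `n`. This keeps the
-- two neighbours of a cycle vertex apart.
k≢k+2-% : ∀ n .{{_ : N.NonZero n}} → 3 ≤ n → ∀ k → k % n ≢ suc (suc k) % n
k≢k+2-% n 3≤n zero    h with () ← trans (Eq.sym (m<n⇒m%n≡m (N.≤-trans (s≤s z≤n) 3≤n))) (trans h (m<n⇒m%n≡m 3≤n))
k≢k+2-% n 3≤n (suc k) h = k≢k+2-% n 3≤n k (suc-%-cancel n k (suc (suc k)) h)

-- One orientation of `Consec`, with the wrap-around absorbed by the remainder.
Next : ∀ n .{{_ : N.NonZero n}} → Fin n → Fin n → Set
Next n a b = toℕ b ≡ suc (toℕ a) % n

Next⇒Consec : ∀ n .{{_ : N.NonZero n}} a b → Next n a b → Consec n a b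
Next⇒Consec n a b h with N.m≤n⇒m<n∨m≡n (toℕ<n a)
... | inj₁ a+1<n = inj₁ (Eq.sym (trans h (m<n⇒m%n≡m a+1<n)))
... | inj₂ a+1≡n = inj₂ (inj₂ (inj₂ (trans h (trans (cong (_% n) a+1≡n) (n%n≡0 n)) , a+1≡n)))

Consec-sym : ∀ n a b → Consec n a b → Consec n b a
Consec-sym n a b (inj₁ h)               = inj₂ (inj₁ h)
Consec-sym n a b (inj₂ (inj₁ h))        = inj₁ h
Consec-sym n a b (inj₂ (inj₂ (inj₁ h))) = inj₂ (inj₂ (inj₂ h))
Consec-sym n a b (inj₂ (inj₂ (inj₂ h))) = inj₂ (inj₂ (inj₁ h))

Consec⇒Next : ∀ n .{{_ : N.NonZero n}} a b → Consec n a b → Next n a b ⊎ Next n b a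
Consec⇒Next n a b = λ where
    (inj₁ h)                       → inj₁ (step< a b h)
    (inj₂ (inj₁ h))                → inj₂ (step< b a h)
    (inj₂ (inj₂ (inj₁ (a≡0 , h)))) → inj₂ (wrap b a a≡0 h)
    (inj₂ (inj₂ (inj₂ (b≡0 , h)))) → inj₁ (wrap a b b≡0 h)
  where
  step< : ∀ x y → suc (toℕ x) ≡ toℕ y → Next n x y
  step< x y h = trans (Eq.sym h) (Eq.sym (m<n⇒m%n≡m (subst (_< n) (Eq.sym h) (toℕ<n y))))
  wrap : ∀ x y → toℕ y ≡ 0 → suc (toℕ x) ≡ n → Next n x y
  wrap x y y≡0 h = trans y≡0 (Eq.sym (trans (cong (_% n) h) (n%n≡0 n)))

-- Sequences with vanishing second difference

affine : ∀ (t : ℕ → ℤ) → (∀ k → t k + t (suc (suc k)) ≡ + 2 * t (suc k)) →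
         ∀ k → t k ≡ t 0 + + k * (t 1 - t 0)
affine t h zero          = base (t 0) (t 1)
  where
  base : ∀ a b → a ≡ a + + 0 * (b - a)
  base = solve-∀
affine t h (suc zero)    = base (t 0) (t 1)
  where
  base : ∀ a b → b ≡ a + + 1 * (b - a)
  base = solve-∀
affine t h (suc (suc k)) = begin
  t (suc (suc k))                          ≡⟨ isolate (t k) (t (suc (suc k))) ⟩
  t k + t (suc (suc k)) - t k              ≡⟨ cong (_- t k) (h k) ⟩
  + 2 * t (suc k) - t k                    ≡⟨ cong₂ (λ a b → + 2 * a - b) (affine t h (suc k)) (affine t h k) ⟩
  + 2 * (t 0 + + suc k * δ) - (t 0 + + k * δ)
                                           ≡⟨ extrapolate (t 0) (+ k) δ ⟩
  t 0 + + suc (suc k) * δ                  ∎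
  where
  δ = t 1 - t 0
  isolate : ∀ a b → b ≡ a + b - a
  isolate = solve-∀
  extrapolate : ∀ a k δ → + 2 * (a + (+ 1 + k) * δ) - (a + k * δ) ≡ a + (+ 2 + k) * δ
  extrapolate = solve-∀

-- Such a sequence is an arithmetic progression; returning to its start after `suc n` steps forces
-- the common difference to be zero.
harmonic-periodic⇒constant : ∀ n (t : ℕ → ℤ) → (∀ k → t k + t (suc (suc k)) ≡ + 2 * t (suc k)) →
                             t (suc n) ≡ t 0 → ∀ k → t k ≡ t 0
harmonic-periodic⇒constant n t h p k = begin
  t k                ≡⟨ affine t h k ⟩
  t 0 + + k * δ      ≡⟨ cong (λ x → t 0 + + k * x) δ≡0 ⟩
  t 0 + + k * + 0    ≡⟨ cong (_+_ (t 0)) (*-zeroʳ (+ k)) ⟩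
  t 0 + + 0          ≡⟨ +-identityʳ (t 0) ⟩
  t 0                ∎
  where
  δ = t 1 - t 0
  isolate : ∀ a b → b ≡ a + b - a
  isolate = solve-∀
  nδ≡0 : + suc n * δ ≡ + 0
  nδ≡0 = begin
    + suc n * δ                  ≡⟨ isolate (t 0) _ ⟩
    t 0 + + suc n * δ - t 0      ≡⟨ cong (_- t 0) (affine t h (suc n)) ⟨
    t (suc n) - t 0              ≡⟨ cong (_- t 0) p ⟩
    t 0 - t 0                    ≡⟨ +-inverseʳ (t 0) ⟩
    + 0                          ∎
  δ≡0 : δ ≡ + 0
  δ≡0 with i*j≡0⇒i≡0∨j≡0 (+ suc n) nδ≡0
  ... | inj₂ z = z

-- Cycle matrices in cyclic coordinates

module CycleMatrix {n-1 : ℕ} (B : Mat (suc n-1)) (cyc : IsCycleMatrix B) (3≤n : 3 ≤ suc n-1) where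

  n : ℕ
  n = suc n-1

  π : Permutation′ n
  π = proj₁ cyc

  -- The k-th vertex of the cycle, indices being read modulo n.
  σ : ℕ → Fin n
  σ k = π ⟨$⟩ˡ (k mod n)

  position-σ : ∀ k → toℕ (π ⟨$⟩ʳ σ k) ≡ k % n
  position-σ k = trans (cong toℕ (inverseʳ π)) (toℕ-fromℕ< (m%n<n k n))

  σ-unique : ∀ k j → toℕ (π ⟨$⟩ʳ j) ≡ k % n → j ≡ σ k
  σ-unique k j h = begin
    j                        ≡⟨ inverseˡ π ⟨
    π ⟨$⟩ˡ (π ⟨$⟩ʳ j)        ≡⟨ cong (π ⟨$⟩ˡ_) (toℕ-injective (trans h (Eq.sym (toℕ-fromℕ< (m%n<n k n))))) ⟩
    σ k                      ∎

  -- An index of the form `suc k` makes both neighbours, `σ k` and `σ (suc (suc k))`, expressible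
  -- without predecessors; adding `n-1` under the successor shifts by one full period.
  σ-surjective : ∀ j → ∃[ k ] j ≡ σ (suc k)
  σ-surjective j = toℕ (π ⟨$⟩ʳ j) N.+ n-1 , σ-unique (suc (toℕ (π ⟨$⟩ʳ j) N.+ n-1)) j (begin
    toℕ (π ⟨$⟩ʳ j)                         ≡⟨ m<n⇒m%n≡m (toℕ<n (π ⟨$⟩ʳ j)) ⟨
    toℕ (π ⟨$⟩ʳ j) % n                     ≡⟨ [m+n]%n≡m%n (toℕ (π ⟨$⟩ʳ j)) n ⟨
    (toℕ (π ⟨$⟩ʳ j) N.+ n) % n             ≡⟨ cong (_% n) (N.+-suc (toℕ (π ⟨$⟩ʳ j)) n-1) ⟩
    suc (toℕ (π ⟨$⟩ʳ j) N.+ n-1) % n       ∎)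

  Next-σ : ∀ k → Next n (π ⟨$⟩ʳ σ k) (π ⟨$⟩ʳ σ (suc k))
  Next-σ k = trans (position-σ (suc k))
    (trans (Eq.sym (suc-%-cong n k)) (cong (λ r → suc r % n) (Eq.sym (position-σ k))))

  neighbours : ∀ k j → Consec n (π ⟨$⟩ʳ σ (suc k)) (π ⟨$⟩ʳ j) → σ k ≡ j ⊎ σ (suc (suc k)) ≡ j
  neighbours k j c with Consec⇒Next n _ _ c
  ... | inj₁ h = inj₂ (Eq.sym (σ-unique (suc (suc k)) j
                   (trans h (trans (cong (λ r → suc r % n) (position-σ (suc k))) (suc-%-cong n (suc k))))))
  ... | inj₂ h = inj₁ (Eq.sym (σ-unique k j
                   (trans (Eq.sym (m<n⇒m%n≡m (toℕ<n (π ⟨$⟩ʳ j))))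
                          (suc-%-cancel n _ k (trans (Eq.sym h) (position-σ (suc k)))))))

  σ-distinct : ∀ k → σ k ≢ σ (suc (suc k))
  σ-distinct k h = k≢k+2-% n 3≤n k
    (trans (Eq.sym (position-σ k)) (trans (cong (λ j → toℕ (π ⟨$⟩ʳ j)) h) (position-σ (suc (suc k)))))

  -- The row is the sum of two unit rows. The second is packed into a matrix with all rows equal, so
  -- that `app-⊕` and `app-Id` evaluate it.
  B-row : ∀ k j → B (σ (suc k)) j ≡ (Id ⊕ λ _ → Id (σ (suc (suc k)))) (σ k) j
  B-row k j with σ k F.≟ j | σ (suc (suc k)) F.≟ j
  -- Coinciding neighbours would give the entry 2.
  ... | yes refl | yes q    = contradiction (Eq.sym q) (σ-distinct k)
  ... | yes refl | no  _    = proj₁ (proj₂ cyc _ _) (Consec-sym n _ _ (Next⇒Consec n _ _ (Next-σ k)))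
  ... | no  _    | yes refl = proj₁ (proj₂ cyc _ _) (Next⇒Consec n _ _ (Next-σ (suc k)))
  ... | no  ¬p   | no  ¬q   = proj₂ (proj₂ cyc _ _) λ c → [ ¬p , ¬q ]′ (neighbours k j c)

  app-B : ∀ v k → app B v (σ (suc k)) ≡ v (σ k) + v (σ (suc (suc k)))
  app-B v k = begin
    app B v (σ (suc k))                               ≡⟨ ∑-cong (λ j → cong (_* v j) (B-row k j)) ⟩
    app (Id ⊕ λ _ → Id (σ (suc (suc k)))) v (σ k)     ≡⟨ app-⊕ Id (λ _ → Id (σ (suc (suc k)))) v (σ k) ⟩
    app Id v (σ k) + app Id v (σ (suc (suc k)))       ≡⟨ cong₂ _+_ (app-Id v (σ k)) (app-Id v (σ (suc (suc k)))) ⟩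
    v (σ k) + v (σ (suc (suc k)))                     ∎

  on-σ : (P : Fin n → Set) → (∀ k → P (σ (suc k))) → ∀ i → P i
  on-σ P h i = let k , i≡σ = σ-surjective i in subst P (Eq.sym i≡σ) (h k)

  app-B-ones : ∀ i → app B (λ _ → + 1) i ≡ + 2
  app-B-ones = on-σ _ (app-B (λ _ → + 1))

  -- The eigenvalue -2 of an even cycle

  module Even (alt-n : alt n ≡ + 1) where

    w : Vect n
    w i = alt (toℕ (π ⟨$⟩ʳ i))

    w-σ : ∀ k → w (σ k) ≡ alt k
    w-σ k = trans (cong alt (position-σ k)) (alt-% n alt-n k)

    app-B-w : ∀ i → app B w i ≡ - + 2 * w i
    app-B-w = on-σ _ λ k → begin
      app B w (σ (suc k))              ≡⟨ app-B w k ⟩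
      w (σ k) + w (σ (suc (suc k)))    ≡⟨ cong₂ _+_ (w-σ k) (w-σ (suc (suc k))) ⟩
      alt k + - - alt k                ≡⟨ double (alt k) ⟩
      - + 2 * - alt k                  ≡⟨ cong (_*_ (- + 2)) (w-σ (suc k)) ⟨
      - + 2 * w (σ (suc k))            ∎
      where
      double : ∀ a → a + - - a ≡ - + 2 * - a
      double = solve-∀

    ∑-w : ∑ℤ n w ≡ + 0
    ∑-w = trans (∑-permute n (λ i → alt (toℕ i)) π) (∑-alt-even n alt-n)

    -- Multiplying by the signs turns the eigenvector equation into harmonicity along the cycle.
    eigenspace-is-line : ∀ u → (∀ i → app B u i ≡ - + 2 * u i) → ∀ i → u i ≡ u (σ 0) * w i
    eigenspace-is-line u h = on-σ _ λ k → begin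
      u (σ (suc k))                                    ≡⟨ *-identityˡ _ ⟨
      + 1 * u (σ (suc k))                              ≡⟨ cong (_* u (σ (suc k))) (alt*alt (suc k)) ⟨
      alt (suc k) * alt (suc k) * u (σ (suc k))        ≡⟨ *-assoc (alt (suc k)) (alt (suc k)) (u (σ (suc k))) ⟩
      alt (suc k) * t (suc k)
        ≡⟨ cong (_*_ (alt (suc k))) (harmonic-periodic⇒constant n-1 t harmonic periodic (suc k)) ⟩
      alt (suc k) * (+ 1 * u (σ 0))                    ≡⟨ cong (_*_ (alt (suc k))) (*-identityˡ (u (σ 0))) ⟩
      alt (suc k) * u (σ 0)                            ≡⟨ *-comm (alt (suc k)) (u (σ 0)) ⟩
      u (σ 0) * alt (suc k)                            ≡⟨ cong (_*_ (u (σ 0))) (w-σ (suc k)) ⟨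
      u (σ 0) * w (σ (suc k))                          ∎
      where
      t : ℕ → ℤ
      t k = alt k * u (σ k)
      harmonic : ∀ k → t k + t (suc (suc k)) ≡ + 2 * t (suc k)
      harmonic k = begin
        alt k * u (σ k) + - - alt k * u (σ (suc (suc k)))
          ≡⟨ factor (alt k) (u (σ k)) (u (σ (suc (suc k)))) ⟩
        alt k * (u (σ k) + u (σ (suc (suc k))))
          ≡⟨ cong (_*_ (alt k)) (trans (Eq.sym (app-B u k)) (h (σ (suc k)))) ⟩
        alt k * (- + 2 * u (σ (suc k)))
          ≡⟨ move (alt k) (u (σ (suc k))) ⟩
        + 2 * (- alt k * u (σ (suc k))) ∎
        where
        factor : ∀ a x y → a * x + - - a * y ≡ a * (x + y)
        factor = solve-∀
        move : ∀ a x → a * (- + 2 * x) ≡ + 2 * (- a * x)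
        move = solve-∀
      periodic : t n ≡ t 0
      periodic = cong₂ _*_ alt-n (cong u (Eq.sym (σ-unique n (σ 0)
        (trans (position-σ 0) (Eq.sym (n%n≡0 n))))))

-- Regular graphs whose polynomial matrix is `J + εB`

alt-even : ∀ n → + 2 ∣ + n → alt n ≡ + 1
alt-even n h with ∣⇒∣ᵤ h
... | ∣ᵤ.divides q n≡q*2 = trans (cong alt n≡q*2) (alt-multiple 2 refl q)

module _ {n-1 : ℕ} (G : Graph (suc n-1)) (d m : ℕ) (reg : Regular G d) (3≤n : 3 ≤ suc n-1)
         (B : Mat (suc n-1)) (cyc : IsCycleMatrix B) (ε : ℤ) (ε*ε : ε * ε ≡ + 1)
         (G≡J+εB : ∀ i j → Gmat d m (AdjMat G) i j ≡ + 1 + ε * B i j) where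

  open CycleMatrix B cyc 3≤n

  A : Mat n
  A = AdjMat G

  row-sum : ∀ i → ∑ℤ n (A i) ≡ + d
  row-sum i = trans (∑-indicator (adj G i)) (cong +_ (reg i))

  app-J+εB : ∀ v i → gapp d m A v i ≡ ∑ℤ n v + ε * app B v i
  app-J+εB v i = begin
    gapp d m A v i                     ≡⟨ app-Gmat d m A v i ⟨
    app (Gmat d m A) v i               ≡⟨ app-congˡ v G≡J+εB i ⟩
    app (Jm ⊕ (ε · B)) v i             ≡⟨ app-⊕ Jm (ε · B) v i ⟩
    app Jm v i + app (ε · B) v i       ≡⟨ cong₂ _+_ (∑-cong λ k → *-identityˡ (v k)) (app-· ε B v i) ⟩
    ∑ℤ n v + ε * app B v i             ∎

  -- Both sides of the matrix equation are applied to the all-ones vector, which `A` multiplies by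
  -- `d` and `B` by 2.
  order : gpoly d m (+ d) ≡ + n + ε * + 2
  order = begin
    gpoly d m (+ d)                          ≡⟨ *-identityʳ _ ⟨
    gpoly d m (+ d) * + 1                    ≡⟨ gapp-eigen d m A (λ _ → + 1) (+ d) eigen (σ 0) ⟨
    gapp d m A (λ _ → + 1) (σ 0)             ≡⟨ app-J+εB (λ _ → + 1) (σ 0) ⟩
    ∑ℤ n (λ _ → + 1) + ε * app B (λ _ → + 1) (σ 0)
      ≡⟨ cong₂ (λ a b → a + ε * b) (∑-1 n) (app-B-ones (σ 0)) ⟩
    + n + ε * + 2                            ∎
    where
    eigen : ∀ i → app A (λ _ → + 1) i ≡ + d * + 1
    eigen i = trans (∑-*ʳ n (+ 1) (A i)) (cong (_* + 1) (row-sum i))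

  -- The vector `A w` again lies in the eigenspace of -2, a line, so `w` is an eigenvector of `A`.
  -- Evaluating the matrix equation on `w`, whose sum is zero, leaves only `ε * B`.
  gpoly-attains-−2ε : + 2 ∣ gpoly d m (+ d) → ∃[ c ] (c ≤ d × gpoly d m (+ d - + 2 * + c) ≡ - + 2 * ε)
  gpoly-attains-−2ε even = c , c≤d , (begin
    gpoly d m (+ d - + 2 * + c)      ≡⟨ cong (gpoly d m) x≡ ⟨
    gpoly d m x                      ≡⟨ *-identityʳ _ ⟨
    gpoly d m x * + 1                ≡⟨ cong (gpoly d m x *_) (w-σ 0) ⟨
    gpoly d m x * w (σ 0)            ≡⟨ gapp-eigen d m A w x (eigenspace-is-line (app A w) app-B-Aw) (σ 0) ⟨
    gapp d m A w (σ 0)               ≡⟨ gapp-w (σ 0) ⟩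
    ε * (- + 2 * w (σ 0))            ≡⟨ cong (λ a → ε * (- + 2 * a)) (w-σ 0) ⟩
    ε * (- + 2 * + 1)                ≡⟨ *-comm ε _ ⟩
    - + 2 * ε                        ∎)
    where
    2∣n : + 2 ∣ + n
    2∣n = subst (+ 2 ∣_) (trans (cong (_- ε * + 2) order) (cancel (+ n) (ε * + 2)))
            (∣m∣n⇒∣m-n even (∣n⇒∣m*n ε ∣-refl))
      where
      cancel : ∀ a b → a + b - b ≡ a
      cancel = solve-∀

    open Even (alt-even n 2∣n)

    gapp-w : ∀ i → gapp d m A w i ≡ ε * (- + 2 * w i)
    gapp-w i = trans (app-J+εB w i) (trans (cong₂ (λ a b → a + ε * b) ∑-w (app-B-w i)) (+-identityˡ _))

    column-sum : ∀ k → ∑ℤ n (λ i → A i k) ≡ + d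
    column-sum k = trans (∑-cong λ i → cong indicator (sym G i k)) (row-sum k)

    ∑-Aw : ∑ℤ n (app A w) ≡ + 0
    ∑-Aw = trans (∑-app A (+ d) column-sum w) (trans (cong (+ d *_) ∑-w) (*-zeroʳ (+ d)))

    app-B-Aw : ∀ i → app B (app A w) i ≡ - + 2 * app A w i
    app-B-Aw i = begin
      app B (app A w) i                       ≡⟨ *-identityˡ _ ⟨
      + 1 * app B (app A w) i                 ≡⟨ cong (_* app B (app A w) i) ε*ε ⟨
      ε * ε * app B (app A w) i               ≡⟨ *-assoc ε ε _ ⟩
      ε * (ε * app B (app A w) i)             ≡⟨ cong (ε *_) εBAw ⟩
      ε * (ε * (- + 2 * app A w i))           ≡⟨ *-assoc ε ε _ ⟨
      ε * ε * (- + 2 * app A w i)             ≡⟨ cong (_* (- + 2 * app A w i)) ε*ε ⟩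
      + 1 * (- + 2 * app A w i)               ≡⟨ *-identityˡ _ ⟩
      - + 2 * app A w i                       ∎
      where
      -- As `A w` has sum zero, `J` kills it and `ε * B` acts on it as the polynomial in `A`, which
      -- can be moved past `A` onto `w`. The sign is cancelled afterwards through `ε*ε`.
      εBAw : ε * app B (app A w) i ≡ ε * (- + 2 * app A w i)
      εBAw = begin
        ε * app B (app A w) i                       ≡⟨ +-identityˡ _ ⟨
        + 0 + ε * app B (app A w) i                 ≡⟨ cong (_+ ε * app B (app A w) i) ∑-Aw ⟨
        ∑ℤ n (app A w) + ε * app B (app A w) i      ≡⟨ app-J+εB (app A w) i ⟨
        gapp d m A (app A w) i                      ≡⟨ gapp-comm d m A w i ⟩
        app A (gapp d m A w) i                      ≡⟨ app-congʳ A gapp-w i ⟩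
        app A (λ k → ε * (- + 2 * w k)) i           ≡⟨ app-* A ε (λ k → - + 2 * w k) i ⟩
        ε * app A (λ k → - + 2 * w k) i             ≡⟨ cong (ε *_) (app-* A (- + 2) w i) ⟩
        ε * (- + 2 * app A w i)                     ∎

    x : ℤ
    -- Since `w` is 1 at `σ 0`, the eigenvalue is the entry of `A w` there: a sum of 13 signs in the
    -- application, `d` in general.
    x = app A w (σ 0)

    count = signed-count (adj G (σ 0)) (λ j → toℕ (π ⟨$⟩ʳ j))

    c : ℕ
    c = proj₁ count

    c≤d : c ≤ d
    c≤d = subst (c ≤_) (reg (σ 0)) (proj₁ (proj₂ count))

    x≡ : x ≡ + d - + 2 * + c
    x≡ = trans (proj₂ (proj₂ count)) (cong (λ e → + e - + 2 * + c) (reg (σ 0)))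

-- Degree 13

gpoly13-attains : ∀ {n} (G : Graph n) m → 2 ≤ m → Regular G 13 → 3 ≤ n → (B : Mat n) → IsCycleMatrix B →
  ∀ ε → ε * ε ≡ + 1 → (∀ i j → Gmat 13 m (AdjMat G) i j ≡ + 1 + ε * B i j) →
  ∃[ c ] ∃[ k ] gpoly 13 (k N.+ 2) (eigenvalue c) ≡ - + 2 * ε
gpoly13-attains {suc _} G m 2≤m reg 3≤n B cyc ε ε*ε eq =
  -- The congruences start at index 2, hence the offset.
  let k = m ∸ 2
      m≡ = N.m∸n+n≡m 2≤m
      c , c≤13 , h = gpoly-attains-−2ε G 13 m reg 3≤n B cyc ε ε*ε eq
                       (subst (λ l → + 2 ∣ gpoly 13 l (+ 13)) m≡ (gpoly[13]-even k))
  in F.fromℕ< (s≤s c≤13) , k ,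
     trans (cong₂ (λ l c → gpoly 13 l (+ 13 - + 2 * + c)) m≡ (toℕ-fromℕ< (s≤s c≤13))) h

theorem10 : ((n D : ℕ) → 3 ≤ D → D ≤ 20000 → (G : Graph n) → ¬ CyclicDefect n 13 D G)
    × ((n g : ℕ) → g % 2 ≡ 1 → 7 ≤ g → g ≤ 40001 → (G : Graph n) → ¬ CyclicExcess n 13 g G)
theorem10 = noDefect , noExcess
  where
  noDefect : (n D : ℕ) → 3 ≤ D → D ≤ 20000 → (G : Graph n) → ¬ CyclicDefect n 13 D G
  noDefect n D _ _ G (3≤n , reg , _ , _ , 2≤D , B , cyc , eq) =
    -- For a defect `ε` is 1, so the value -2 would be attained.
    let c , k , h = gpoly13-attains G D 2≤D reg 3≤n B cyc (+ 1) refl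
                      (λ i j → trans (eq i j) (cong (_+_ (+ 1)) (Eq.sym (*-identityˡ (B i j)))))
    in gpoly≢-2 c k h
  noExcess : (n g : ℕ) → g % 2 ≡ 1 → 7 ≤ g → g ≤ 40001 → (G : Graph n) → ¬ CyclicExcess n 13 g G
  noExcess n g _ _ _ G (3≤n , reg , _ , _ , _ , 5≤g , B , cyc , eq) =
    -- For an excess `ε` is -1, so the value 2 would be attained; halving `5 ≤ g` puts the index at
    -- 2 or more.
    let c , k , h = gpoly13-attains G (g / 2) (/-monoˡ-≤ 2 5≤g) reg 3≤n B cyc (- + 1) refl
                      (λ i j → trans (eq i j) (cong (_+_ (+ 1)) (Eq.sym (-1*i≡-i (B i j)))))
    in gpoly≢2 c k h
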